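{- Any $G_{\delta\sigma}$ ideal $\mathcal J$ on $\omega$ is extendable to an $F_\sigma$ ideal, i.e. there is an $F_\sigma$ ideal $\mathcal J'$ on $\omega$ with $\mathcal J\subseteq\mathcal J'$.
   Context: An ideal on $\omega$ is a family of subsets of $\omega$ closed under finite unions and subsets, containing all finite sets and not containing $\omega$. $F_\sigma$ and $G_{\delta\sigma}$ (countable unions of $G_\delta$ sets) refer to subsets of $\mathcal P(\omega)$ with the Cantor space topology, identifying sets with characteristic functions in $\{0,1\}^\omega$. -}

module Defs where

open import Data.Bool using (Bool; true; T; _∨_)
open import Data.List using (List)
open import Data.List.Membership.Propositional using () renaming (_∈_ to _∈ˡ_)
open import Data.Nat using (ℕ; _<_)
open import Data.Product using (Σ; ∃; _×_)
open import Level using (0ℓ; suc)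
open import Relation.Binary.PropositionalEquality using (_≡_)
open import Relation.Unary using (Pred; _∈_; _∉_; _≐_; ∁; ⋃; ⋂)

-- 𝒫(ω), identified with the Cantor space {0,1}^ω: a subset of ω is its
-- characteristic function.
𝒫ω : Set
𝒫ω = ℕ → Bool

infix 4 _∈ω_ _⊆ω_
infixr 6 _∪ω_

_∈ω_ : ℕ → 𝒫ω → Set
n ∈ω A = T (A n)

_⊆ω_ : 𝒫ω → 𝒫ω → Set
A ⊆ω B = ∀ n → n ∈ω A → n ∈ω B

_∪ω_ : 𝒫ω → 𝒫ω → 𝒫ω
(A ∪ω B) n = A n ∨ B n

ω : 𝒫ω
ω _ = true

Finite : 𝒫ω → Set
Finite A = Σ (List ℕ) λ xs → ∀ n → n ∈ω A → n ∈ˡ xs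

-- Under excluded middle for Set every proposition is decided, so predicates
-- valued in Set already comprise all families of subsets of ω.
Family : Set₁
Family = Pred 𝒫ω 0ℓ

-- Being closed under ⊆ω, an ideal automatically respects pointwise equality of
-- characteristic functions, so function extensionality is never needed.
-- The empty union is covered by finite-in.
record IsIdeal (𝒥 : Family) : Set where
  field
    ∪-closed  : ∀ A B → A ∈ 𝒥 → B ∈ 𝒥 → (A ∪ω B) ∈ 𝒥
    ⊆-closed  : ∀ A B → A ⊆ω B → B ∈ 𝒥 → A ∈ 𝒥
    finite-in : ∀ A → Finite A → A ∈ 𝒥
    ω-out     : ω ∉ 𝒥

-- The product topology on {0,1}^ω: the basic neighbourhoods of A are the
-- cylinders fixing the first n values of A.
IsOpen : Pred Family 0ℓ
IsOpen U = ∀ A → A ∈ U →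
  ∃ λ n → ∀ B → (∀ i → i < n → A i ≡ B i) → B ∈ U

IsClosed : Pred Family 0ℓ
IsClosed C = IsOpen (∁ C)

IsGδ : Pred Family (suc 0ℓ)
IsGδ S = Σ (ℕ → Family) λ U → (∀ n → IsOpen (U n)) × S ≐ ⋂ ℕ U

IsFσ : Pred Family (suc 0ℓ)
IsFσ S = Σ (ℕ → Family) λ C → (∀ n → IsClosed (C n)) × S ≐ ⋃ ℕ C

IsGδσ : Pred Family (suc 0ℓ)
IsGδσ S = Σ (ℕ → Family) λ G → (∀ n → IsGδ (G n)) × S ≐ ⋃ ℕ G

{-# OPTIONS --safe #-}
module Submission where

-- Call a set positive if it is not in 𝒥, and call a family small on c if A ∩ c is
-- in 𝒥 for all its members A.  The proof finds a positive set c and countably many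
-- closed families that are small on c and cover 𝒥 (small-cover).  The ideal that
-- these families generate is then as required.  It is Fσ since, by compactness, the
-- subsets of unions X ∪ Y with X and Y in a closed family form a closed family
-- (belowUnions-closed).  It is proper since finite unions of sets small on c are small
-- on c, whereas ω ∩ c is not in 𝒥.
--
-- Everything rests on one construction (two-branches): if H is a nonempty part of a
-- Gδ family, and every finite initial part of a member of H can be continued inside
-- H so as to contain d from some place on, as far as desired, then two members of
-- the Gδ family together contain d up to finitely many elements.  When the family
-- is contained in 𝒥, it follows that d is not positive.
--
-- A first application is that 𝒥 is a P⁺-ideal: a decreasing sequence of positive
-- sets has a positive pseudo-intersection (pseudo-intersection).  This allows
-- forcing arguments with positive sets ordered by almost inclusion, in which
-- countably many dense requirements are met at once (fusion).
--
-- A second application concerns a nonempty part H of one of the Gδ families whose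
-- union is 𝒥.  Below any positive set there are a positive d and a cylinder [ p ]
-- meeting H such that the closure of H ∩ [ p ] is small on d (small-piece).  One c
-- obtained by fusion decides for all these Gδ families and all cylinders whether
-- the part in the cylinder has a countable closed cover that is small on c.  What
-- is left of a Gδ family after the covered parts are removed must then be empty.

open import Axiom.ExcludedMiddle using (ExcludedMiddle)
open import Data.Bool using (Bool; true; false; T; _∧_)
open import Data.Bool.Properties using (T-∧; T-∨)
open import Data.Empty using (⊥)
open import Data.List using (List; []; _∷_; length; applyUpTo; upTo)
open import Data.List.Properties using (length-applyUpTo)
open import Data.List.Membership.Propositional.Properties using (∈-upTo⁺)
open import Data.Nat
  using (ℕ; zero; suc; _+_; _⊔_; _≤_; _<_; _≤′_; ≤′-refl; ≤′-step; _<ᵇ_; _<?_; z≤n; s≤s; s<s)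
open import Data.Nat.GeneralisedArithmetic using (fold)
open import Data.Nat.Properties
open import Data.Product using (Σ; ∃; ∃₂; _×_; _,_; proj₁; proj₂)
open import Data.Sum using (_⊎_; inj₁; inj₂; [_,_]′)
import Data.Sum as Sum
open import Function using (_∘_; id; Equivalence)
open import Level using (0ℓ)
open import Relation.Binary.PropositionalEquality using (_≡_; refl; sym; trans; cong; subst)
open import Relation.Nullary using (¬_; yes; no; contradiction)
open import Relation.Nullary.Decidable using (⌊_⌋; toWitness; fromWitness; decidable-stable; toSum)
open import Relation.Unary using (_∈_; _∉_; _⊆_; _∩_; _∪_; ⋃; ⋂)
open import Defs

-- Sequences and countability

abstract
  dependent-choice : {S : Set} {R : ℕ → S → S → Set} → S →
    (∀ k s → ∃ (R k s)) → Σ (ℕ → S) λ f → ∀ k → R k (f k) (f (suc k))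
  dependent-choice {S} {R} s₀ step = f , λ k → proj₂ (step k (f k))
    where
    f : ℕ → S
    f zero    = s₀
    f (suc k) = proj₁ (step k (f k))

≤-monotone : {R : ℕ → ℕ → Set} → (∀ {n} → R n n) →
  (∀ {m} n → R m n → R m (suc n)) → ∀ {m n} → m ≤ n → R m n
≤-monotone {R} reflexive step = go ∘ ≤⇒≤′
  where
  go : ∀ {m n} → m ≤′ n → R m n
  go ≤′-refl     = reflexive
  go (≤′-step l) = step _ (go l)

module _ {L : ℕ → ℕ} (increasing : ∀ k → L k < L (suc k)) where

  private
    L-unbounded : ∀ d n → d ≤ L (d + n)
    L-unbounded zero    n = z≤n
    L-unbounded (suc d) n = ≤-<-trans (L-unbounded d n) (increasing (d + n))

    search : ∀ {n i} d → L n ≤ i → i < L (d + n) →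
      ∃ λ m → n ≤ m × L m ≤ i × i < L (suc m)
    search zero Ln≤i i<Ln = contradiction i<Ln (≤⇒≯ Ln≤i)
    search {n} {i} (suc d) Ln≤i i<L with i <? L (d + n)
    ... | yes i<L′ = search d Ln≤i i<L′
    ... | no  i≮L′ = d + n , m≤n+m n d , ≮⇒≥ i≮L′ , i<L

  interval-of : ∀ {n i} → L n ≤ i → ∃ λ m → n ≤ m × L m ≤ i × i < L (suc m)
  interval-of {n} {i} Ln≤i = search (suc i) Ln≤i (L-unbounded (suc i) n)

  index≤value : ∀ k → k ≤ L k
  index≤value zero    = z≤n
  index≤value (suc k) = ≤-<-trans (index≤value k) (increasing k)

private
  next : ℕ × ℕ → ℕ × ℕ
  next (zero  , b) = suc b , zero
  next (suc a , b) = a , suc b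

-- The walk through ℕ × ℕ along the finite diagonals a + b = s.
unpair : ℕ → ℕ × ℕ
unpair = fold (0 , 0) next

unpair-surjective : ∀ a b → ∃ λ k → unpair k ≡ (a , b)
unpair-surjective a b = on-diagonal (a + b) a b refl
  where
  on-diagonal : ∀ s a b → a + b ≡ s → ∃ λ k → unpair k ≡ (a , b)
  on-diagonal s a (suc b) eq
    with k , p ← on-diagonal s (suc a) b (trans (sym (+-suc a b)) eq)
    = suc k , cong next p
  on-diagonal zero    zero    zero eq = zero , refl
  on-diagonal (suc s) (suc a) zero eq
    with k , p ← on-diagonal s zero a (trans (sym (+-identityʳ a)) (suc-injective eq))
    = suc k , cong next p

private
  increment : List Bool → List Bool
  increment []           = false ∷ []
  increment (false ∷ xs) = true ∷ xs
  increment (true ∷ xs)  = false ∷ increment xs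

-- Bijective binary numeration, least significant digit first: false and true
-- are the digits 1 and 2.
word : ℕ → List Bool
word = fold [] increment

word-surjective : ∀ xs → ∃ λ k → word k ≡ xs
word-surjective [] = 0 , refl
word-surjective (x ∷ xs) with k , refl ← word-surjective xs = prepend x
  where
  word-odd : ∀ n → word (suc (n + n)) ≡ false ∷ word n
  word-odd zero = refl
  word-odd (suc n) rewrite +-suc n n | word-odd n = refl

  prepend : ∀ x → ∃ λ j → word j ≡ x ∷ word k
  prepend false = suc (k + k) , word-odd k
  prepend true  = suc (suc (k + k)) , cong increment (word-odd k)

-- Subsets of ω

infix 4 _⊆*_
infixr 7 _∩ω_

_∩ω_ : 𝒫ω → 𝒫ω → 𝒫ω
(A ∩ω B) n = A n ∧ B n

_⊆*_ : 𝒫ω → 𝒫ω → Set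
A ⊆* B = ∃ λ m → ∀ n → m ≤ n → n ∈ω A → n ∈ω B

below : ℕ → 𝒫ω
below m n = n <ᵇ m

module _ {A B : 𝒫ω} {n : ℕ} where

  ∈-∩⁺ : n ∈ω A → n ∈ω B → n ∈ω A ∩ω B
  ∈-∩⁺ a b = Equivalence.from (T-∧ {A n} {B n}) (a , b)

  ∈-∩⁻ : n ∈ω A ∩ω B → n ∈ω A × n ∈ω B
  ∈-∩⁻ = Equivalence.to (T-∧ {A n} {B n})

  ∈-∪⁺ : n ∈ω A ⊎ n ∈ω B → n ∈ω A ∪ω B
  ∈-∪⁺ = Equivalence.from (T-∨ {A n} {B n})

  ∈-∪⁻ : n ∈ω A ∪ω B → n ∈ω A ⊎ n ∈ω B
  ∈-∪⁻ = Equivalence.to (T-∨ {A n} {B n})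

⊆⇒⊆* : ∀ {A B} → A ⊆ω B → A ⊆* B
⊆⇒⊆* A⊆B = 0 , λ n _ → A⊆B n

⊆*-refl : ∀ {A} → A ⊆* A
⊆*-refl {A} = ⊆⇒⊆* {A} λ _ n∈A → n∈A

⊆*-trans : ∀ {A B C} → A ⊆* B → B ⊆* C → A ⊆* C
⊆*-trans (l , A⊆B) (m , B⊆C) = l ⊔ m , λ n l⊔m≤n a →
  B⊆C n (≤-trans (m≤n⊔m l m) l⊔m≤n) (A⊆B n (≤-trans (m≤m⊔n l m) l⊔m≤n) a)

-- Cylinders

Agree : ℕ → 𝒫ω → 𝒫ω → Set
Agree n A B = ∀ i → i < n → A i ≡ B i

module _ {n : ℕ} where

  agree-refl : ∀ {A} → Agree n A A
  agree-refl _ _ = refl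

  agree-sym : ∀ {A B} → Agree n A B → Agree n B A
  agree-sym AB i i<n = sym (AB i i<n)

  agree-trans : ∀ {A B C} → Agree n A B → Agree n B C → Agree n A C
  agree-trans AB BC i i<n = trans (AB i i<n) (BC i i<n)

agree-≤ : ∀ {m n A B} → m ≤ n → Agree n A B → Agree m A B
agree-≤ m≤n AB i i<m = AB i (<-≤-trans i<m m≤n)

agree-∈ : ∀ {n A B i} → Agree n A B → i < n → i ∈ω A → i ∈ω B
agree-∈ AB i<n = subst T (AB _ i<n)

splice : ℕ → 𝒫ω → 𝒫ω → 𝒫ω
splice n A B i with i <? n
... | yes _ = A i
... | no  _ = B i

splice-agree : ∀ n A B → Agree n A (splice n A B)
splice-agree n A B i i<n with i <? n
... | yes _   = refl
... | no  i≮n = contradiction i<n i≮n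

splice-tail : ∀ n A B {i} → n ≤ i → B i ≡ splice n A B i
splice-tail n A B {i} n≤i with i <? n
... | yes i<n = contradiction i<n (≤⇒≯ n≤i)
... | no  _   = refl

infix 5 _↾_
infix 4 _≼_

-- A finite 0-1 sequence, presented as the restriction of an infinite one.
record Cylinder : Set where
  constructor _↾_
  field
    point  : 𝒫ω
    height : ℕ

open Cylinder

[_] : Cylinder → Family
[ p ] A = Agree (height p) (point p) A

_≼_ : Cylinder → Cylinder → Set
p ≼ q = height p ≤ height q × point q ∈ [ p ]

≼-trans : ∀ {p q r} → p ≼ q → q ≼ r → p ≼ r
≼-trans (pq , a) (qr , b) = ≤-trans pq qr , agree-trans a (agree-≤ pq b)

≼-⊆ : ∀ {p q} → p ≼ q → [ q ] ⊆ [ p ]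
≼-⊆ (pq , a) b = agree-trans a (agree-≤ pq b)

-- The value at i is read off from p (suc i), whose height exceeds i.
limit : (p : ℕ → Cylinder) → (∀ k → p k ≼ p (suc k)) →
  (∀ k → height (p k) < height (p (suc k))) → ∃ λ A → ∀ k → A ∈ [ p k ]
limit p chain increasing = A , A∈
  where
  A : 𝒫ω
  A i = point (p (suc i)) i

  chain≤ : ∀ {k l} → k ≤ l → p k ≼ p l
  chain≤ = ≤-monotone {λ k l → p k ≼ p l} (≤-refl , agree-refl)
    (λ l k≼l → ≼-trans k≼l (chain l))

  A∈ : ∀ k → A ∈ [ p k ]
  A∈ k i i<hk with ≤-total k (suc i)
  ... | inj₁ k≤1+i = proj₂ (chain≤ k≤1+i) i i<hk
  ... | inj₂ 1+i≤k = sym (proj₂ (chain≤ 1+i≤k) i (index≤value increasing (suc i)))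

private
  digit : List Bool → 𝒫ω
  digit []       _       = false
  digit (x ∷ xs) zero    = x
  digit (x ∷ xs) (suc i) = digit xs i

  digit-applyUpTo : ∀ A n → Agree n A (digit (applyUpTo A n))
  digit-applyUpTo A (suc n) zero    _         = refl
  digit-applyUpTo A (suc n) (suc i) (s<s i<n) = digit-applyUpTo (A ∘ suc) n i i<n

cylinder : ℕ → Cylinder
cylinder k = digit (word k) ↾ length (word k)

cylinder-surjective : ∀ p → ∃ λ k → p ≼ cylinder k × cylinder k ≼ p
cylinder-surjective (A ↾ n) with k , eq ← word-surjective (applyUpTo A n) =
  k , (≤-reflexive (sym height≡n) , agree)
    , (≤-reflexive height≡n , agree-≤ (≤-reflexive height≡n) (agree-sym agree))
  where
  height≡n : length (word k) ≡ n
  height≡n = trans (cong length eq) (length-applyUpTo A n)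

  agree : Agree n A (point (cylinder k))
  agree = subst (λ xs → Agree n A (digit xs)) (sym eq) (digit-applyUpTo A n)

-- Pairs of branches covering a given set

Entering : (Cylinder → Set) → Family → Cylinder → Set
Entering P V p = ∃ λ q → P q × p ≼ q × [ q ] ⊆ V

Following : (Cylinder → Set) → 𝒫ω → ℕ → ℕ → Cylinder → Set
Following P c n m p = ∃ λ q → P q × p ≼ q × m ≤ height q ×
  (∀ i → n ≤ i → i < m → i ∈ω c → i ∈ω point q)

-- P is a set of conditions whose branches can be made to enter all the U k.  The
-- hypothesis cover says that the extensions of a condition can follow c as far as
-- desired, but only from a place that depends on the condition and that may lie
-- above its height.  Hence one branch does not suffice and two are built
-- alternately: after one of them has been extended into U k, the other one goes
-- on following c up to the place from which the first can take over.
module TwoBranches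
  (P : Cylinder → Set) (U : ℕ → Family) (c : 𝒫ω)
  (enter : ∀ k p → P p → Entering P (U k) p)
  (cover : ∀ p → P p → ∃ λ n → ∀ m → Following P c n m p)
  where

  private
    from : ∀ {p} → P p → ℕ
    from Pp = proj₁ (cover _ Pp)

    -- From the level on, right can follow c while left is being extended.
    record Stage : Set where
      field
        left right : Cylinder
        left∈P     : P left
        right∈P    : P right
        level      : ℕ
        ready      : from right∈P ≤ level

    open Stage

    record Step (k : ℕ) (s t : Stage) : Set where
      field
        left≼     : left s ≼ left t
        right≼    : right s ≼ right t
        left<     : height (left s) < height (left t)
        right<    : height (right s) < height (right t)
        level<    : level s < level t
        left⊆U    : [ left t ] ⊆ U k
        right⊆U   : [ right t ] ⊆ U k
        covered   : ∀ i → level s ≤ i → i < level t → i ∈ω c →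
          (i < height (left t) × i ∈ω point (left t)) ⊎
          (i < height (right t) × i ∈ω point (right t))

    -- First right follows c up to the place from which left can, then left up to
    -- the place from which right can.  The second argument of each maximum makes
    -- heights and levels grow.
    advance : ∀ {k} s → ((p , Pp , _) : Entering P (U k) (left s)) →
      ((q , _) : Following P c (from (right∈P s))
                   (from Pp ⊔ suc (level s ⊔ height (right s))) (right s)) →
      ((q′ , Pq′ , _) : Entering P (U k) q) →
      Following P c (from Pp) (from Pq′ ⊔ suc (level s ⊔ height p)) p →
      ∃ (Step k s)
    advance s (p , Pp , s≼p , p⊆U) (q , _ , s≼q , hq , q⊇c)
              (q′ , Pq′ , q≼q′ , q′⊆U) (p′ , Pp′ , p≼p′ , hp′ , p′⊇c)
      = record
        { left = p′ ; right = q′ ; left∈P = Pp′ ; right∈P = Pq′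
        ; level = from Pq′ ⊔ suc (level s ⊔ height p) ; ready = m≤m⊔n (from Pq′) _ }
      , record
        { left≼   = ≼-trans s≼p p≼p′
        ; right≼  = ≼-trans s≼q q≼q′
        ; left<   = ≤-trans (s≤s (proj₁ s≼p))
            (≤-trans (above (level s) (height p) (from Pq′)) hp′)
        ; right<  = ≤-trans (above (level s) (height (right s)) (from Pp))
            (≤-trans hq (proj₁ q≼q′))
        ; level<  = ≤-trans (s≤s (m≤m⊔n (level s) (height p))) (m≤n⊔m (from Pq′) _)
        ; left⊆U  = p⊆U ∘ ≼-⊆ p≼p′
        ; right⊆U = q′⊆U
        ; covered = covered
        }
      where
      above : ∀ l h a → h < a ⊔ suc (l ⊔ h)
      above l h a = ≤-trans (s≤s (m≤n⊔m l h)) (m≤n⊔m a _)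

      covered : ∀ i → level s ≤ i → i < from Pq′ ⊔ suc (level s ⊔ height p) → i ∈ω c →
        (i < height p′ × i ∈ω point p′) ⊎ (i < height q′ × i ∈ω point q′)
      covered i s≤i i<l i∈c with <-≤-connex i (from Pp)
      ... | inj₂ ≤i = inj₁ (<-≤-trans i<l hp′ , p′⊇c i ≤i i<l i∈c)
      ... | inj₁ i< = inj₂ (<-≤-trans i<q (proj₁ q≼q′) , agree-∈ (proj₂ q≼q′) i<q
                              (q⊇c i (≤-trans (ready s) s≤i) i<m i∈c))
        where
        i<m = <-≤-trans i< (m≤m⊔n (from Pp) _)
        i<q = <-≤-trans i<m hq

    step : ∀ k s → ∃ (Step k s)
    step k s = advance s entering following entering′ (proj₂ (cover _ _) _)
      where
      entering  = enter k (left s) (left∈P s)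
      following = proj₂ (cover (right s) (right∈P s)) _
      entering′ = enter k _ (proj₁ (proj₂ following))

    branches : (stage : ℕ → Stage) → (∀ k → Step k (stage k) (stage (suc k))) →
      ∃₂ λ A B → A ∈ ⋂ ℕ U × B ∈ ⋂ ℕ U × c ⊆* A ∪ω B
    branches stage steps
      with A , A∈ ← limit (left ∘ stage) (Step.left≼ ∘ steps) (Step.left< ∘ steps)
      with B , B∈ ← limit (right ∘ stage) (Step.right≼ ∘ steps) (Step.right< ∘ steps)
      = A , B
      , (λ k → Step.left⊆U (steps k) (A∈ (suc k)))
      , (λ k → Step.right⊆U (steps k) (B∈ (suc k)))
      , level (stage 0) , λ i 0≤i i∈c →
          let k , _ , k≤i , i<k+1 = interval-of (Step.level< ∘ steps) {0} 0≤i in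
          ∈-∪⁺ {A} {B} (Sum.map
            (λ (i<h , i∈) → agree-∈ (A∈ (suc k)) i<h i∈)
            (λ (i<h , i∈) → agree-∈ (B∈ (suc k)) i<h i∈)
            (Step.covered (steps k) i k≤i i<k+1 i∈c))

  abstract
    two-branches : ∃ P → ∃₂ λ A B → A ∈ ⋂ ℕ U × B ∈ ⋂ ℕ U × c ⊆* A ∪ω B
    two-branches (p , Pp) =
      let stage , steps = dependent-choice {R = Step} start step in branches stage steps
      where
      start : Stage
      start = record { left = p ; right = p ; left∈P = Pp ; right∈P = Pp
                     ; level = from Pp ; ready = ≤-refl }

open TwoBranches using (two-branches)

module _ (em : ExcludedMiddle 0ℓ) where

  by-contradiction : {P : Set} → ¬ ¬ P → P
  by-contradiction = decidable-stable em

  -- Closed families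

  closure : Family → Family
  closure S A = ∀ n → ∃ λ B → B ∈ S × Agree n A B

  closed⇒closure⊆ : ∀ {S} → IsClosed S → closure S ⊆ S
  closed⇒closure⊆ closed {A} A∈ = by-contradiction λ A∉S →
    let n , outside = closed A A∉S
        B , B∈S , AB = A∈ n in
    outside B AB B∈S

  closure⊆⇒closed : ∀ {S} → closure S ⊆ S → IsClosed S
  closure⊆⇒closed closure⊆ A A∉S = by-contradiction λ ∄n → A∉S (closure⊆ λ n →
    by-contradiction λ ∄B → ∄n (n , λ B AB B∈S → ∄B (B , B∈S , AB)))

  closure-closed : ∀ S → IsClosed (closure S)
  closure-closed S = closure⊆⇒closed {closure S} λ A∈ n →
    let B , B∈ , AB = A∈ n
        C , C∈S , BC = B∈ n in
    C , C∈S , agree-trans AB BC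

  closed-∪ : ∀ {S S′} → IsClosed S → IsClosed S′ → IsClosed (S ∪ S′)
  closed-∪ closed closed′ A A∉ =
    let m , outside = closed A (A∉ ∘ inj₁)
        n , outside′ = closed′ A (A∉ ∘ inj₂) in
    m ⊔ n , λ B AB → [ outside B (agree-≤ (m≤m⊔n m n) AB)
                     , outside′ B (agree-≤ (m≤n⊔m m n) AB) ]′

  -- Sequential compactness of the Cantor space.
  cluster-point : (X : ℕ → 𝒫ω) →
    Σ 𝒫ω λ A → Σ (ℕ → ℕ) λ φ → ∀ k → k ≤ φ k × Agree k A (X (φ k))
  cluster-point X = finish (dependent-choice {R = Step} start step)
    where
    Recurrent : Cylinder → Set
    Recurrent p = ∀ m → ∃ λ n → m ≤ n × X n ∈ [ p ]

    Step : ℕ → ∃ Recurrent → ∃ Recurrent → Set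
    Step _ (p , _) (q , _) = p ≼ q × height p < height q

    start : ∃ Recurrent
    start = ω ↾ 0 , λ m → m , ≤-refl , λ _ ()

    append : Cylinder → Bool → Cylinder
    append p b = splice (height p) (point p) (λ _ → b) ↾ suc (height p)

    ∈-append : ∀ {p A b} → A ∈ [ p ] → A (height p) ≡ b → A ∈ [ append p b ]
    ∈-append {p} {A} {b} A∈ eq i i≤h with m<1+n⇒m<n∨m≡n i≤h
    ... | inj₁ i<h  = trans (sym (splice-agree (height p) (point p) _ i i<h)) (A∈ i i<h)
    ... | inj₂ refl = trans (sym (splice-tail (height p) (point p) _ ≤-refl)) (sym eq)

    step : ∀ k s → ∃ (Step k s)
    step _ (p , recurrent) with em {Recurrent (append p true)}
    ... | yes recurrent′ =
      (append p true , recurrent′) , (n≤1+n _ , splice-agree _ _ _) , ≤-refl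
    ... | no ¬recurrent =
      (append p false , recurrent′) , (n≤1+n _ , splice-agree _ _ _) , ≤-refl
      where
      recurrent′ : Recurrent (append p false)
      recurrent′ m = by-contradiction λ ∄n → ¬recurrent λ m′ →
        let n , m⊔m′≤n , Xn∈ = recurrent (m ⊔ m′) in
        n , ≤-trans (m≤n⊔m m m′) m⊔m′≤n ,
        decide n Xn∈ λ eq → ∄n (n , ≤-trans (m≤m⊔n m m′) m⊔m′≤n , ∈-append Xn∈ eq)
        where
        decide : ∀ n → X n ∈ [ p ] → ¬ X n (height p) ≡ false → X n ∈ [ append p true ]
        decide n Xn∈ ≢false with X n (height p) in eq
        ... | true  = ∈-append Xn∈ eq
        ... | false = contradiction refl ≢false

    finish : (∃ λ s → ∀ k → Step k (s k) (s (suc k))) →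
      Σ 𝒫ω λ A → Σ (ℕ → ℕ) λ φ → ∀ k → k ≤ φ k × Agree k A (X (φ k))
    finish (s , steps) = proj₁ A,A∈ , φ , λ k →
      let _ , k≤n , Xn∈ = proj₂ (s k) k in
      k≤n , agree-≤ (index≤value (proj₂ ∘ steps) k)
              (agree-trans (agree-sym (proj₂ A,A∈ k)) Xn∈)
      where
      A,A∈ : ∃ λ A → ∀ k → A ∈ [ proj₁ (s k) ]
      A,A∈ = limit (proj₁ ∘ s) (proj₁ ∘ steps) (proj₂ ∘ steps)

      φ : ℕ → ℕ
      φ k = proj₁ (proj₂ (s k) k)

  BelowUnions : Family → Family
  BelowUnions S A = ∃₂ λ X Y → X ∈ S × Y ∈ S × A ⊆ω X ∪ω Y

  -- A limit of sets below X n ∪ω Y n lies below the union of a cluster point of the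
  -- X n and one of the Y n, taken along a common subsequence.
  belowUnions-closed : ∀ {S} → IsClosed S → IsClosed (BelowUnions S)
  belowUnions-closed {S} closed = closure⊆⇒closed {BelowUnions S} λ {A} A∈ → limit-union A A∈
    where
    limit-union : ∀ A → closure (BelowUnions S) A → BelowUnions S A
    limit-union A A∈ =
      let X∞ , φ , X→X∞ = cluster-point X
          Y∞ , ψ , Y→Y∞ = cluster-point (Y ∘ φ) in
      X∞ , Y∞
      , closed⇒closure⊆ closed (λ k → X (φ k) , X∈ (φ k) , proj₂ (X→X∞ k))
      , closed⇒closure⊆ closed (λ k → Y (φ (ψ k)) , Y∈ (φ (ψ k)) , proj₂ (Y→Y∞ k))
      , λ i i∈A →
        let k    = ψ (suc i)
            i<k  = proj₁ (Y→Y∞ (suc i))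
            i<φk = ≤-trans i<k (proj₁ (X→X∞ k)) in
        ∈-∪⁺ {X∞} {Y∞} (Sum.map
          (agree-∈ (agree-sym (proj₂ (X→X∞ k))) i<k)
          (agree-∈ (agree-sym (proj₂ (Y→Y∞ (suc i)))) ≤-refl)
          (∈-∪⁻ {X (φ k)} {Y (φ k)} (B⊆ (φ k) i (agree-∈ (AB (φ k)) i<φk i∈A))))
      where
      B X Y : ℕ → 𝒫ω
      B n = proj₁ (A∈ n)
      X n = proj₁ (proj₁ (proj₂ (A∈ n)))
      Y n = proj₁ (proj₂ (proj₁ (proj₂ (A∈ n))))

      X∈ : ∀ n → X n ∈ S
      X∈ n = proj₁ (proj₂ (proj₂ (proj₁ (proj₂ (A∈ n)))))

      Y∈ : ∀ n → Y n ∈ S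
      Y∈ n = proj₁ (proj₂ (proj₂ (proj₂ (proj₁ (proj₂ (A∈ n))))))

      B⊆ : ∀ n → B n ⊆ω X n ∪ω Y n
      B⊆ n = proj₂ (proj₂ (proj₂ (proj₂ (proj₁ (proj₂ (A∈ n))))))

      AB : ∀ n → Agree n A (B n)
      AB n = proj₂ (proj₂ (A∈ n))

  -- Positive sets

  module _ {𝒥 : Family} (ideal : IsIdeal 𝒥) where
    open IsIdeal ideal

    ⊆*-closed : ∀ {A B} → A ⊆* B → B ∈ 𝒥 → A ∈ 𝒥
    ⊆*-closed {A} {B} (m , A⊆B) B∈ =
      ⊆-closed A (B ∪ω below m) split (∪-closed B (below m) B∈ below∈)
      where
      below∈ : below m ∈ 𝒥
      below∈ = finite-in (below m) (upTo m , λ n n<m → ∈-upTo⁺ (<ᵇ⇒< n m n<m))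

      split : A ⊆ω B ∪ω below m
      split n a = ∈-∪⁺ {B} {below m}
        ([ (λ n<m → inj₂ (<⇒<ᵇ n<m)) , (λ m≤n → inj₁ (A⊆B n m≤n a)) ]′ (<-≤-connex n m))

    module _ {U : ℕ → ℕ → Family} (U-open : ∀ n k → IsOpen (U n k))
             (𝒥⊆⋃⋂U : 𝒥 ⊆ ⋃[ n ∶ ℕ ] ⋂ ℕ (U n)) (⋂U⊆𝒥 : ∀ n → ⋂ ℕ (U n) ⊆ 𝒥)
             where

      private
        _≼⟨_⟩_ : Cylinder → 𝒫ω → Cylinder → Set
        p ≼⟨ c ⟩ q = p ≼ q ×
          (∀ i → height p ≤ i → i < height q → i ∈ω point q → i ∈ω c)

        _↾↾_ : Cylinder → 𝒫ω → Family
        (p ↾↾ c) A = A ∈ [ p ] × (∀ i → height p ≤ i → i ∈ω A → i ∈ω c)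

        Avoiding : ℕ → 𝒫ω → Cylinder → Cylinder → Set
        Avoiding n c p q =
          p ≼⟨ c ⟩ q × height p < height q × ∃ λ k → ∀ A → (q ↾↾ c) A → A ∉ U n k

        -- If no finite extension of p inside c could exclude membership in
        -- ⋂ ℕ (U n) for good, that family would be dense among the continuations
        -- of p inside c, and two of its members would cover c up to a finite set.
        avoid : ∀ n c → c ∉ 𝒥 → ∀ p → ∃ (Avoiding n c p)
        avoid n c c∉ p = by-contradiction λ ∄q →
          let A , B , A∈ , B∈ , c⊆ = two-branches P (U n) c (enter ∄q) cover start in
          c∉ (⊆*-closed c⊆ (∪-closed A B (⋂U⊆𝒥 n A∈) (⋂U⊆𝒥 n B∈)))
          where
          P : Cylinder → Set
          P q = p ≼⟨ c ⟩ q × height p < height q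

          extend : ∀ {q r} → P q → q ≼ r →
            (∀ i → height q ≤ i → i < height r → i ∈ω point r → i ∈ω c) → P r
          extend {q} {r} ((p≼q , q⊆c) , p<q) q≼r r⊆c =
            (≼-trans p≼q q≼r , λ i p≤i i<r i∈r → [
              (λ i<q → q⊆c i p≤i i<q (agree-∈ (agree-sym (proj₂ q≼r)) i<q i∈r)) ,
              (λ q≤i → r⊆c i q≤i i<r i∈r) ]′ (<-≤-connex i (height q)))
            , <-≤-trans p<q (proj₁ q≼r)

          enter : ¬ ∃ (Avoiding n c p) →
            ∀ k q → P q → Entering P (U n k) q
          enter ∄q k q Pq@(p≼q , p<q) = by-contradiction λ ∄r →
            ∄q (q , p≼q , p<q , k , λ A (A∈q , A⊆c) A∈U →
              let m , Am⊆U = U-open n k A A∈U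
                  q≼r = m≤n⊔m m (height q) , A∈q in
              ∄r ( A ↾ m ⊔ height q
                 , extend Pq q≼r (λ i q≤i _ i∈A → A⊆c i q≤i i∈A)
                 , q≼r
                 , λ {B} B∈ → Am⊆U B (agree-≤ (m≤m⊔n m (height q)) B∈)))

          fill : Cylinder → ℕ → Cylinder
          fill q m = splice (height q) (point q) c ↾ m ⊔ height q

          ≼-fill : ∀ q m → q ≼ fill q m
          ≼-fill q m = m≤n⊔m m (height q) , splice-agree (height q) (point q) c

          cover : ∀ q → P q → ∃ λ l → ∀ m → Following P c l m q
          cover q Pq = height q , λ m →
            fill q m
            , extend Pq (≼-fill q m)
                (λ i q≤i _ → subst T (sym (splice-tail (height q) (point q) c q≤i)))
            , ≼-fill q m
            , m≤m⊔n m (height q)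
            , λ i q≤i _ → subst T (splice-tail (height q) (point q) c q≤i)

          start : ∃ P
          start = fill p (suc (height p))
            , (≼-fill p _
              , λ i p≤i _ → subst T (sym (splice-tail (height p) (point p) c p≤i)))
            , m≤m⊔n (suc (height p)) (height p)

        diagonal : (c : ℕ → 𝒫ω) → (∀ n → c (suc n) ⊆ω c n) →
          (p : ℕ → Cylinder) → (∀ n → Avoiding n (c n) (p n) (p (suc n))) →
          ∃ λ d → d ∉ 𝒥 × ∀ n → d ⊆* c n
        diagonal c decreasing p steps = d , d∉ , λ n → height (p n) , d⊆ n
          where
          increasing : ∀ n → height (p n) < height (p (suc n))
          increasing n = proj₁ (proj₂ (steps n))

          d,d∈ : ∃ λ d → ∀ n → d ∈ [ p n ]
          d,d∈ = limit p (λ n → proj₁ (proj₁ (steps n))) increasing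

          d : 𝒫ω
          d = proj₁ d,d∈

          d∈ : ∀ n → d ∈ [ p n ]
          d∈ = proj₂ d,d∈

          c-mono : ∀ {n m} → n ≤ m → c m ⊆ω c n
          c-mono = ≤-monotone {λ n m → c m ⊆ω c n} (λ _ i∈ → i∈)
            (λ m m⊆n i → m⊆n i ∘ decreasing m i)

          d⊆ : ∀ n i → height (p n) ≤ i → i ∈ω d → i ∈ω c n
          d⊆ n i n≤i i∈d
            with m , n≤m , m≤i , i<m+1 ← interval-of increasing {n} n≤i
            = c-mono n≤m i (proj₂ (proj₁ (steps m)) i m≤i i<m+1
                (agree-∈ (agree-sym (d∈ (suc m))) i<m+1 i∈d))

          d∉ : d ∉ 𝒥
          d∉ d∈𝒥 with n , d∈U ← 𝒥⊆⋃⋂U d∈𝒥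
                  with _ , _ , k , avoids ← steps n =
            avoids d (d∈ (suc n) , λ i n+1≤i i∈d → decreasing n i (d⊆ (suc n) i n+1≤i i∈d)) (d∈U k)

      -- The sets not in 𝒥 form a P⁺-family.  The pseudo-intersection is made
      -- positive by a diagonalisation against the Gδ families whose union is 𝒥.
      pseudo-intersection : (c : ℕ → 𝒫ω) → (∀ n → c n ∉ 𝒥) →
        (∀ n → c (suc n) ⊆ω c n) → ∃ λ d → d ∉ 𝒥 × ∀ n → d ⊆* c n
      pseudo-intersection c c∉ decreasing =
        let p , steps = dependent-choice {R = λ n → Avoiding n (c n)}
                          ((λ _ → false) ↾ 0) (λ n → avoid n (c n) (c∉ n)) in
        diagonal c decreasing p steps

      -- Requirements that are dense among the positive sets, and that pass to
      -- almost smaller sets, can be met countably many at a time.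
      fusion : ∀ c → c ∉ 𝒥 → (R : ℕ → 𝒫ω → Set) →
        (∀ k {d d′} → d ⊆* d′ → R k d′ → R k d) →
        (∀ k a → a ∉ 𝒥 → a ⊆ω c → ∃ λ d → d ∉ 𝒥 × d ⊆* a × R k d) →
        ∃ λ d → d ∉ 𝒥 × d ⊆* c × ∀ k → R k d
      fusion c c∉ R inherited dense =
        intersect (dependent-choice {R = Step} start step)
        where
        Stage : Set
        Stage = ∃ λ a → a ∉ 𝒥 × a ⊆ω c

        start : Stage
        start = c , c∉ , λ _ n∈c → n∈c

        Step : ℕ → Stage → Stage → Set
        Step k (a , _) (b , _) = b ⊆ω a × R k b

        step : ∀ k a → ∃ (Step k a)
        step k (a , a∉ , a⊆c) =
          let b , b∉ , (m , b⊆a) , Rb = dense k a a∉ a⊆c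
              b⊆*b∩a = m , λ n m≤n n∈b → ∈-∩⁺ {b} {a} n∈b (b⊆a n m≤n n∈b) in
          ( b ∩ω a
          , (λ b∩a∈ → b∉ (⊆*-closed b⊆*b∩a b∩a∈))
          , λ n → a⊆c n ∘ proj₂ ∘ ∈-∩⁻ {b} {a})
          , (λ n → proj₂ ∘ ∈-∩⁻ {b} {a})
          , inherited k (⊆⇒⊆* {b ∩ω a} {b} (λ n → proj₁ ∘ ∈-∩⁻ {b} {a})) Rb

        intersect : (Σ (ℕ → Stage) λ a → ∀ k → Step k (a k) (a (suc k))) →
          ∃ λ d → d ∉ 𝒥 × d ⊆* c × ∀ k → R k d
        intersect (a , steps) =
          let d , d∉ , d⊆* = pseudo-intersection (proj₁ ∘ a)
                (λ k → proj₁ (proj₂ (a k))) (λ k → proj₁ (steps k)) in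
          d , d∉
          , ⊆*-trans {d} {proj₁ (a 0)} {c} (d⊆* 0) (⊆⇒⊆* {proj₁ (a 0)} (proj₂ (proj₂ (a 0))))
          , λ k → inherited k (d⊆* (suc k)) (proj₂ (steps k))

      -- Small families and covers

      Small : 𝒫ω → Family → Set
      Small d S = ∀ A → A ∈ S → A ∩ω d ∈ 𝒥

      -- Otherwise a fusion, going through all cylinders that meet H, would yield a
      -- positive d almost contained in a member of the closure of each H ∩ [ p ].
      -- Every initial part of a member of H could then be continued inside H so
      -- as to follow d, and two members of ⋂ ℕ (U n), being limits of such parts,
      -- would cover d up to a finite set.
      small-piece : ∀ n {H : Family} → H ⊆ ⋂ ℕ (U n) → ∃ H → ∀ c → c ∉ 𝒥 →
        ∃₂ λ p d → ∃ (H ∩ [ p ]) × d ∉ 𝒥 × d ⊆* c × Small d (closure (H ∩ [ p ]))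
      small-piece n {H} H⊆⋂U (H₀ , H₀∈H) c c∉ = by-contradiction λ none →
        let d , d∉ , d⊆c , large = fusion c c∉ R inherited (dense none)
            A , B , A∈ , B∈ , d⊆ = two-branches P (U n) d enter (cover d large) start in
        d∉ (⊆*-closed d⊆ (∪-closed A B (⋂U⊆𝒥 n A∈) (⋂U⊆𝒥 n B∈)))
        where
        P : Cylinder → Set
        P p = ∃ (H ∩ [ p ])

        start : ∃ P
        start = ω ↾ 0 , H₀ , H₀∈H , λ _ ()

        R : ℕ → 𝒫ω → Set
        R k d = P (cylinder k) → ∃ λ A → A ∈ closure (H ∩ [ cylinder k ]) × d ⊆* A

        inherited : ∀ k {d d′} → d ⊆* d′ → R k d′ → R k d
        inherited k {d} {d′} d⊆d′ Rd′ meets =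
          let A , A∈ , d′⊆A = Rd′ meets in A , A∈ , ⊆*-trans {d} {d′} {A} d⊆d′ d′⊆A

        dense : ¬ (∃₂ λ p d → P p × d ∉ 𝒥 × d ⊆* c × Small d (closure (H ∩ [ p ]))) →
          ∀ k a → a ∉ 𝒥 → a ⊆ω c → ∃ λ d → d ∉ 𝒥 × d ⊆* a × R k d
        dense none k a a∉ a⊆c with em {P (cylinder k)}
        ... | no ¬meets = a , a∉ , ⊆*-refl {a} , λ meets → contradiction meets ¬meets
        ... | yes meets =
          let A , A∈ , A∩a∉ = positive in
          A ∩ω a , A∩a∉ , ⊆⇒⊆* {A ∩ω a} (λ _ → proj₂ ∘ ∈-∩⁻ {A} {a})
          , λ _ → A , A∈ , ⊆⇒⊆* {A ∩ω a} (λ _ → proj₁ ∘ ∈-∩⁻ {A} {a})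
          where
          positive : ∃ λ A → A ∈ closure (H ∩ [ cylinder k ]) × A ∩ω a ∉ 𝒥
          positive = by-contradiction λ ∄A →
            none (cylinder k , a , meets , a∉ , ⊆⇒⊆* {a} a⊆c
                 , λ A A∈ → by-contradiction λ A∩a∉ → ∄A (A , A∈ , A∩a∉))

        enter : ∀ k p → P p → Entering P (U n k) p
        enter k p (A , A∈H , A∈p) =
          let m , Am⊆U = U-open n k A (H⊆⋂U A∈H k) in
          A ↾ m ⊔ height p
          , (A , A∈H , agree-refl {A = A})
          , (m≤n⊔m m (height p) , A∈p)
          , λ {B} AB → Am⊆U B (agree-≤ (m≤m⊔n m (height p)) AB)

        cover : ∀ d → (∀ k → R k d) → ∀ p → P p → ∃ λ l → ∀ m → Following P d l m p
        cover d large p (A , A∈H , A∈p) =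
          let k , p≼k , k≼p = cylinder-surjective p
              C , C∈ , l , d⊆C = large k (A , A∈H , ≼-⊆ k≼p A∈p) in
          l , λ m →
            let B , (B∈H , B∈k) , CB = C∈ (m ⊔ height p) in
            B ↾ m ⊔ height p
            , (B , B∈H , agree-refl {A = B})
            , (m≤n⊔m m (height p) , ≼-⊆ p≼k B∈k)
            , m≤m⊔n m (height p)
            , λ i l≤i i<m i∈d →
                agree-∈ CB (<-≤-trans i<m (m≤m⊔n m (height p))) (d⊆C i l≤i i∈d)

      -- The pieces have values in Bool rather than in Set, which keeps the record
      -- in Set and thus within the reach of excluded middle.
      record SmallCover (d : 𝒫ω) (S : Family) : Set where
        field
          piece  : ℕ → 𝒫ω → Bool
          closed : ∀ i → IsClosed (T ∘ piece i)
          small  : ∀ i → Small d (T ∘ piece i)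
          covers : S ⊆ ⋃[ i ∶ ℕ ] (T ∘ piece i)

      open SmallCover

      weaken : ∀ {d d′ S S′} → d ⊆* d′ → S ⊆ S′ → SmallCover d′ S′ → SmallCover d S
      weaken {d} {d′} (m , d⊆d′) S⊆S′ C = record
        { piece  = piece C
        ; closed = closed C
        ; small  = λ i A A∈ → ⊆*-closed
            (m , λ n m≤n n∈ → let n∈A , n∈d = ∈-∩⁻ {A} {d} n∈ in
                 ∈-∩⁺ {A} {d′} n∈A (d⊆d′ n m≤n n∈d))
            (small C i A A∈)
        ; covers = covers C ∘ S⊆S′
        }

      closure-cover : ∀ {d S} → Small d (closure S) → SmallCover d S
      closure-cover {d} {S} small = record
        { piece  = λ _ A → ⌊ em {closure S A} ⌋
        ; closed = λ _ A A∉ →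
            let n , outside = closure-closed S A (A∉ ∘ fromWitness) in
            n , λ B AB → outside B AB ∘ toWitness
        ; small  = λ _ A → small A ∘ toWitness
        ; covers = λ {A} A∈S → 0 , fromWitness (λ n → A , A∈S , agree-refl {A = A})
        }

      ⋃-cover : ∀ {d} {S : ℕ → Family} →
        (∀ i → SmallCover d (S i)) → SmallCover d (⋃ ℕ S)
      ⋃-cover C = record
        { piece  = λ k → let i , j = unpair k in piece (C i) j
        ; closed = λ k → let i , j = unpair k in closed (C i) j
        ; small  = λ k → let i , j = unpair k in small (C i) j
        ; covers = λ {A} (i , A∈Si) →
            let j , A∈ = covers (C i) A∈Si
                k , eq = unpair-surjective i j in
            k , subst (λ (i , j) → T (piece (C i) j A)) (sym eq) A∈
        }

      if-covered : ∀ {d} S → SmallCover d (λ A → A ∈ S × SmallCover d S)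
      if-covered {d} S with em {SmallCover d S}
      ... | yes C = weaken (⊆*-refl {d}) proj₁ C
      ... | no ¬C = record
        { piece  = λ _ _ → false
        ; closed = λ _ _ _ → 0 , λ _ _ ()
        ; small  = λ _ _ ()
        ; covers = λ (_ , C) → contradiction C ¬C
        }

      -- A fusion over all n and all cylinders makes c so small that a part of a
      -- Gδ family has a cover small on c as soon as it has one that is small on
      -- some almost smaller positive d.  Removing the covered parts from a Gδ
      -- family leaves nothing: by small-piece, a nonempty remainder would have a
      -- further part with a cover small on some d.
      small-cover : ∃ λ c → c ∉ 𝒥 × SmallCover c 𝒥
      small-cover =
        let c , c∉ , _ , decided = fusion ω ω-out Decides inherited dense in
        c , c∉ , weaken {c} (⊆*-refl {c}) 𝒥⊆⋃⋂U (⋃-cover (cover c c∉ decided))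
        where
        piece-of : ℕ → ℕ → Family
        piece-of n j = ⋂ ℕ (U n) ∩ [ cylinder j ]

        Decision : Family → 𝒫ω → Set
        Decision S c = SmallCover c S ⊎ (∀ d → d ∉ 𝒥 → d ⊆* c → ¬ SmallCover d S)

        Decides : ℕ → 𝒫ω → Set
        Decides k = let n , j = unpair k in Decision (piece-of n j)

        inherited : ∀ k {d d′} → d ⊆* d′ → Decides k d′ → Decides k d
        inherited k {d} {d′} d⊆d′ = Sum.map (weaken d⊆d′ id)
          λ uncovered e e∉ e⊆d → uncovered e e∉ (⊆*-trans {e} {d} {d′} e⊆d d⊆d′)

        dense : ∀ k a → a ∉ 𝒥 → a ⊆ω ω → ∃ λ d → d ∉ 𝒥 × d ⊆* a × Decides k d
        dense k a a∉ _ with em {∃ λ d → d ∉ 𝒥 × d ⊆* a × SmallCover d _}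
        ... | yes (d , d∉ , d⊆a , C) = d , d∉ , d⊆a , inj₁ C
        ... | no ∄d = a , a∉ , ⊆*-refl {a}
                    , inj₂ λ d d∉ d⊆a C → ∄d (d , d∉ , d⊆a , C)

        cover : ∀ c → c ∉ 𝒥 → (∀ k → Decides k c) → ∀ n → SmallCover c (⋂ ℕ (U n))
        cover c c∉ decided n =
          weaken {c} (⊆*-refl {c}) (λ A∈ → by-contradiction (no-remainder A∈))
            (⋃-cover (if-covered ∘ piece-of n))
          where
          Covered : Family
          Covered A = ∃ λ j → A ∈ piece-of n j × SmallCover c (piece-of n j)

          Remainder : Family
          Remainder A = A ∈ ⋂ ℕ (U n) × A ∉ Covered

          no-remainder : ∀ {A} → A ∈ ⋂ ℕ (U n) → ¬ A ∉ Covered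
          no-remainder A∈U A∉ =
            let p , d , (B , (B∈U , B∉) , B∈p) , d∉ , d⊆c , small =
                  small-piece n {Remainder} proj₁ (_ , A∈U , A∉) c c∉
                j , p≼j , j≼p = cylinder-surjective p
                k , eq        = unpair-surjective n j

                locally : SmallCover d (piece-of n j)
                locally = weaken {d} (⊆*-refl {d})
                  (λ (X∈U , X∈j) → [ (λ X∈ → 1 , X∈)
                                       , (λ X∉ → 0 , (X∈U , X∉) , ≼-⊆ p≼j X∈j) ]′ (toSum em))
                  (⋃-cover {S = parts (Remainder ∩ [ p ])} λ where
                    zero    → closure-cover small
                    (suc _) → weaken d⊆c id (⋃-cover (if-covered ∘ piece-of n)))

                decision : Decision (piece-of n j) c
                decision = subst (λ (n , j) → Decision (piece-of n j) c) eq (decided k)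
            in
            [ (λ C → B∉ (j , (B∈U , ≼-⊆ j≼p B∈p) , C))
            , (λ uncovered → uncovered d d∉ d⊆c locally) ]′ decision
            where
            parts : Family → ℕ → Family
            parts S zero    = S
            parts S (suc _) = Covered

-- The extension

proposition10p1 : ExcludedMiddle 0ℓ →
    (𝒥 : Family) → IsIdeal 𝒥 → IsGδσ 𝒥 →
    Σ Family λ 𝒥′ → IsIdeal 𝒥′ × IsFσ 𝒥′ × (𝒥 ⊆ 𝒥′)
proposition10p1 em 𝒥 ideal (G , Gδ , 𝒥⊆⋃G , ⋃G⊆𝒥) =
  ⋃ ℕ K , K-ideal , (K , K-closed , id , id) , 𝒥⊆K
  where
  open IsIdeal ideal

  U : ℕ → ℕ → Family
  U n = proj₁ (Gδ n)

  cover : ∃ λ c → c ∉ 𝒥 × SmallCover em ideal _ _ _ c 𝒥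
  cover = small-cover em ideal {U}
    (λ n → proj₁ (proj₂ (Gδ n)))
    (λ A∈ → let n , A∈G = 𝒥⊆⋃G A∈ in n , proj₁ (proj₂ (proj₂ (Gδ n))) A∈G)
    (λ n A∈U → ⋃G⊆𝒥 (n , proj₂ (proj₂ (proj₂ (Gδ n))) A∈U))

  c : 𝒫ω
  c = proj₁ cover

  open SmallCover (proj₂ (proj₂ cover))

  -- A single K n need not be closed under unions; doubling at each stage makes the
  -- union of all of them so.
  K : ℕ → Family
  K zero    = λ _ → ⊥
  K (suc n) = BelowUnions em (K n ∪ (T ∘ piece n))

  K-closed : ∀ n → IsClosed (K n)
  K-closed zero    = λ _ _ → 0 , λ _ _ ()
  K-closed (suc n) = belowUnions-closed em (closed-∪ em (K-closed n) (closed n))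

  K-mono : ∀ {m n} → m ≤ n → K m ⊆ K n
  K-mono = ≤-monotone {λ m n → K m ⊆ K n} id λ n m⊆n {A} A∈ →
    A , A , inj₁ (m⊆n A∈) , inj₁ (m⊆n A∈) , λ _ → ∈-∪⁺ {A} {A} ∘ inj₁

  𝒥⊆K : 𝒥 ⊆ ⋃ ℕ K
  𝒥⊆K {A} A∈ = let i , A∈i = covers A∈ in
    suc i , A , A , inj₂ A∈i , inj₂ A∈i , λ _ → ∈-∪⁺ {A} {A} ∘ inj₁

  K-small : ∀ n A → A ∈ K n → A ∩ω c ∈ 𝒥
  K-small (suc n) A (X , Y , X∈ , Y∈ , A⊆X∪Y) =
    ⊆-closed (A ∩ω c) ((X ∩ω c) ∪ω (Y ∩ω c))
      (λ i i∈ → let i∈A , i∈c = ∈-∩⁻ {A} {c} i∈ in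
        ∈-∪⁺ {X ∩ω c} {Y ∩ω c} (Sum.map
          (λ i∈X → ∈-∩⁺ {X} {c} i∈X i∈c) (λ i∈Y → ∈-∩⁺ {Y} {c} i∈Y i∈c)
          (∈-∪⁻ {X} {Y} (A⊆X∪Y i i∈A))))
      (∪-closed (X ∩ω c) (Y ∩ω c) (either X X∈) (either Y Y∈))
    where
    either : ∀ X → X ∈ K n ∪ (T ∘ piece n) → X ∩ω c ∈ 𝒥
    either X = [ K-small n X , small n X ]′

  K-ideal : IsIdeal (⋃ ℕ K)
  K-ideal = record
    { ∪-closed  = λ A B (m , A∈) (n , B∈) →
        suc (m ⊔ n) , A , B
        , inj₁ (K-mono (m≤m⊔n m n) A∈) , inj₁ (K-mono (m≤n⊔m m n) B∈) , λ _ i∈ → i∈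
    ; ⊆-closed  = λ where
        A B A⊆B (suc n , X , Y , X∈ , Y∈ , B⊆) →
          suc n , X , Y , X∈ , Y∈ , λ i → B⊆ i ∘ A⊆B i
    ; finite-in = λ A finite → 𝒥⊆K (finite-in A finite)
    ; ω-out     = λ (n , ω∈) → proj₁ (proj₂ cover)
        (⊆-closed c (ω ∩ω c) (λ _ i∈c → i∈c) (K-small n ω ω∈))
    }
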